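{- Let $k$ be a nonnegative integer and let $\mathcal{F}$ be a family of finite simple graphs each of which has non-chordality index at most $k$. Then $\mathcal{F}$ is $\chi_{DP}$-bounded.
   Context: A class $\mathcal{F}$ of graphs is $\chi_{DP}$-bounded if there is a function $f:\mathbb{N}\to\mathbb{R}$ such that $\chi_{DP}(H)\le f(\omega(H))$ for every $G\in\mathcal{F}$ and every induced subgraph $H$ of $G$; $\chi_{DP}$ is the DP-chromatic (correspondence chromatic) number and $\omega$ the clique number. A hole is an induced cycle of length at least $4$; a graph is chordal if it has no hole. A nonempty set $X\subseteq V(G)$ is a hole cover of $G$ if every hole of $G$ contains a vertex of $X$ (for chordal $G$ any nonempty set is a hole cover). A vertex $u$ satisfies the NC property in $G$ if no hole of $G$ containing $u$ and hole of $G$ not containing $u$ share two consecutive edges; a set $\mathcal{C}$ satisfies the NC property in $G$ if each of its vertices does and every hole of $G$ contains at most one vertex of $\mathcal{C}$. Locally chordalizing a hole $H$ by a vertex $u$ on $H$ means adding an edge $uv$ for every vertex $v$ of $H$ not adjacent to $u$. For a hole cover $\mathcal{D}=\{u_1,\ldots,u_m\}$ of a graph $F$ satisfying the NC property in $F$, $\widehat{F}(\mathcal{D})$ is obtained from $F_0=F$ by letting $F_i$ be obtained from $F_{i-1}$ by locally chordalizing simultaneously all holes of $F_{i-1}$ containing $u_i$ by $u_i$, and taking $F_m$ (independent of ordering). An ordered partition $(\mathcal{C}_1,\ldots,\mathcal{C}_p)$ of a hole cover $\mathcal{C}$ of $G$ is a local chordalization partition if, setting $G_0=G_0^*=G-\mathcal{C}$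 and for $i=1,\ldots,p$ letting $V(G_i)=V(G_{i-1}^*)\cup\mathcal{C}_i$, $E(G_i)=E(G_{i-1}^*)\cup E(G-\bigcup_{j=i+1}^p\mathcal{C}_j)$, $G_i^*=\widehat{G_i}(\mathcal{C}_i)$, each $\mathcal{C}_i$ is a hole cover of $G_i$ satisfying the NC property in $G_i$ and each $G_i^*$ is chordal. The non-chordality index $i(G)$ is $0$ if $G$ is chordal, and otherwise the smallest $p$ such that some hole cover of $G$ has a local chordalization partition into $p$ parts. -}

module Defs where

open import Data.Nat using (ℕ; zero; suc; _≤_)
open import Data.Fin using (Fin; toℕ)
open import Data.Bool using (Bool; true; false)
open import Data.List using (List; []; _∷_; concat)
open import Data.List.Membership.Propositional using (_∈_)
open import Data.List.Relation.Unary.Unique.Propositional using (Unique)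
open import Data.Product using (Σ; ∃; _×_; _,_)
open import Data.Sum using (_⊎_)
open import Data.Unit using (⊤)
open import Data.Empty using (⊥)
open import Relation.Nullary using (¬_)
open import Relation.Binary.PropositionalEquality using (_≡_; _≢_)
open import Function.Definitions using (Injective)

record Graph : Set where
  field
    n       : ℕ
    adj     : Fin n → Fin n → Bool
    adj-sym : ∀ u v → adj u v ≡ adj v u
    adj-irr : ∀ u → adj u u ≡ false
open Graph public

-- The induced subgraph on the image of e (used with e injective).
induced : (G : Graph) (m : ℕ) → (Fin m → Fin (n G)) → Graph
induced G m e = record
  { n = m
  ; adj = λ i j → adj G (e i) (e j)
  ; adj-sym = λ i j → adj-sym G (e i) (e j)
  ; adj-irr = λ i → adj-irr G (e i) }

IsClique : (G : Graph) (s : ℕ) → (Fin s → Fin (n G)) → Set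
IsClique G s c = Injective _≡_ _≡_ c × (∀ i j → i ≢ j → adj G (c i) (c j) ≡ true)

HasClique : Graph → ℕ → Set
HasClique G s = Σ (Fin s → Fin (n G)) (IsClique G s)

CliqueNumber : Graph → ℕ → Set
CliqueNumber G w = HasClique G w × (∀ s → HasClique G s → s ≤ w)

-- A k-fold correspondence cover: for each edge uv a (partial) matching
-- M u v between the lists {u}×[k] and {v}×[k]; no matching on non-edges.
record Cover (G : Graph) (k : ℕ) : Set where
  field
    M       : Fin (n G) → Fin (n G) → Fin k → Fin k → Bool
    M-edge  : ∀ u v i j → M u v i j ≡ true → adj G u v ≡ true
    M-sym   : ∀ u v i j → M u v i j ≡ M v u j i
    M-match : ∀ u v i j j' → M u v i j ≡ true → M u v i j' ≡ true → j ≡ j'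
open Cover public

DPColorable : Graph → ℕ → Set
DPColorable G k = (C : Cover G k) →
  Σ (Fin (n G) → Fin k) λ φ → ∀ u v → M C u v (φ u) (φ v) ≡ false

-- χ_DP(G) ≤ c  (χ_DP is the least k with G DP-k-colourable)
DPχ≤ : Graph → ℕ → Set
DPχ≤ G c = Σ ℕ λ k → k ≤ c × DPColorable G k

-- Graphs with a vertex subset of Fin n (for vertex deletion etc.)

record SG (N : ℕ) : Set₁ where
  field
    V : Fin N → Set
    E : Fin N → Fin N → Set
open SG public

Consec : (l : ℕ) → Fin l → Fin l → Set
Consec l i j = toℕ j ≡ suc (toℕ i) ⊎ toℕ i ≡ suc (toℕ j)
             ⊎ (toℕ i ≡ 0 × suc (toℕ j) ≡ l) ⊎ (toℕ j ≡ 0 × suc (toℕ i) ≡ l)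

record Hole {N : ℕ} (F : SG N) : Set where
  field
    len    : ℕ
    len≥4  : 4 ≤ len
    vs     : Fin len → Fin N
    vs-inj : Injective _≡_ _≡_ vs
    vs-V   : ∀ i → V F (vs i)
    edge⇒  : ∀ i j → E F (vs i) (vs j) → Consec len i j
    ⇒edge  : ∀ i j → Consec len i j → E F (vs i) (vs j)
open Hole public

module _ {N : ℕ} {F : SG N} where
  Contains : Hole F → Fin N → Set
  Contains H u = Σ (Fin (len H)) λ i → vs H i ≡ u

  HoleEdge : Hole F → Fin N → Fin N → Set
  HoleEdge H a b = Σ (Fin (len H)) λ i → Σ (Fin (len H)) λ j →
    Consec (len H) i j × vs H i ≡ a × vs H j ≡ b

  ShareTwoConsec : Hole F → Hole F → Set
  ShareTwoConsec H₁ H₂ = Σ (Fin N) λ a → Σ (Fin N) λ b → Σ (Fin N) λ c →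
    a ≢ c × HoleEdge H₁ a b × HoleEdge H₁ b c × HoleEdge H₂ a b × HoleEdge H₂ b c

Chordal : ∀ {N} → SG N → Set
Chordal F = Hole F → ⊥

HoleCover : ∀ {N} → SG N → List (Fin N) → Set
HoleCover F X = (Σ _ λ x → x ∈ X) × (∀ x → x ∈ X → V F x)
              × ((H : Hole F) → Σ _ λ x → x ∈ X × Contains H x)

NCvertex : ∀ {N} → SG N → Fin N → Set
NCvertex F u = (H₁ H₂ : Hole F) → Contains H₁ u → ¬ Contains H₂ u → ¬ ShareTwoConsec H₁ H₂

NCset : ∀ {N} → SG N → List (Fin N) → Set
NCset F C = (∀ u → u ∈ C → NCvertex F u)
          × ((H : Hole F) → ∀ u v → u ∈ C → v ∈ C → Contains H u → Contains H v → u ≡ v)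

chordalize : ∀ {N} → SG N → Fin N → SG N
chordalize F u = record
  { V = V F
  ; E = λ x y → E F x y ⊎ (x ≢ y × Σ (Hole F) λ H →
                  Contains H x × Contains H y × (x ≡ u ⊎ y ≡ u)) }

hat : ∀ {N} → SG N → List (Fin N) → SG N
hat F []       = F
hat F (u ∷ us) = hat (chordalize F u) us

asSG : (G : Graph) → SG (n G)
asSG G = record { V = λ _ → ⊤ ; E = λ x y → adj G x y ≡ true }

delete : (G : Graph) → List (Fin (n G)) → SG (n G)
delete G X = record
  { V = λ x → ¬ (x ∈ X)
  ; E = λ x y → adj G x y ≡ true × ¬ (x ∈ X) × ¬ (y ∈ X) }

-- Given G*_{i-1} and the remaining parts C_i, …, C_p, the conditions
-- for steps i, …, p.
LCPSteps : (G : Graph) → SG (n G) → List (List (Fin (n G))) → Set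
LCPSteps G H []         = ⊤
LCPSteps G H (C ∷ rest) =
  HoleCover Gi C × NCset Gi C × Chordal (hat Gi C) × LCPSteps G (hat Gi C) rest
  where
  Gi : SG (n G)
  Gi = record { V = λ x → V H x ⊎ x ∈ C
              ; E = λ x y → E H x y ⊎ E (delete G (concat rest)) x y }

-- (C₁, …, C_p) = parts is a local chordalization partition of the
-- hole cover C = C₁ ∪ … ∪ C_p of G.
IsLCP : (G : Graph) → List (List (Fin (n G))) → Set
IsLCP G parts = Unique (concat parts) × HoleCover (asSG G) (concat parts)
              × LCPSteps G (delete G (concat parts)) parts

NCIndex≤ : Graph → ℕ → Set
NCIndex≤ G k = Chordal (asSG G)
  ⊎ (Σ (List (List (Fin (n G)))) λ parts → Data.List.length parts ≤ k × IsLCP G parts)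

{-# OPTIONS --safe #-}
module Submission where

open import Defs
open import Data.Bool using (true; false)
open import Data.Bool.Properties as Bool using (¬-not)
open import Data.Empty using (⊥; ⊥-elim)
open import Data.Fin using (Fin; zero; suc; toℕ; fromℕ; fromℕ<; finToFun; funToFin)
open import Data.Fin.Properties using (_≟_; any?; all?; toℕ-injective; toℕ-fromℕ; toℕ-fromℕ<; toℕ<n; finToFun-funToFin; injective⇒≤)
open import Data.List using (List; []; _∷_; _++_; concat; filter; length; lookup; tabulate)
open import Data.List.Properties using (length-tabulate)
open import Data.List.Membership.Propositional using (_∈_)
open import Data.List.Membership.Propositional.Properties using (∈-++⁺ˡ; ∈-++⁺ʳ; ∈-++⁻; ∈-filter⁻; ∈-lookup; ∈-tabulate⁻)
import Data.List.Membership.DecPropositional as DecMembership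
open import Data.List.Relation.Unary.All as All using (All; []; _∷_)
import Data.List.Relation.Unary.All.Properties as All
open import Data.List.Relation.Unary.AllPairs using ([]; _∷_)
open import Data.List.Relation.Unary.Any as Any using (Any; here; there)
open import Data.List.Relation.Unary.Any.Properties using (lookup-index)
open import Data.List.Relation.Unary.Unique.Propositional using (Unique)
open import Data.List.Relation.Unary.Unique.Propositional.Properties using (filter⁺; tabulate⁺)
open import Data.Nat using (ℕ; zero; suc; _≤_; _<_; _+_; _*_; _^_; _∸_; z≤n; s≤s; _≤′_; ≤′-refl; ≤′-step; NonZero; >-nonZero; _%_)
open import Data.Nat.DivMod using (m%n<n; m<n⇒m%n≡m; n%n≡0; %-distribˡ-+; [m+n]%n≡m%n; m%n%n≡m%n)
open import Data.Nat.Properties hiding (_≟_)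
open import Data.Product using (Σ; ∃; ∃₂; _×_; _,_; proj₁; proj₂)
open import Data.Sum using (_⊎_; inj₁; inj₂; [_,_]′)
open import Function using (_∘_; id)
open import Function.Definitions using (Injective)
open import Relation.Binary.PropositionalEquality using (_≡_; _≢_; refl; sym; trans; cong; subst; subst₂; ≢-sym; module ≡-Reasoning)
open import Relation.Nullary using (¬_; Dec; yes; no; ¬?)
open import Relation.Nullary.Decidable using (¬¬-excluded-middle; decidable-stable; map′)
open import Relation.Unary using (Decidable)

-- Chordalizing at u creates no hole through u. If a and b were the neighbours of u on such a hole, then
-- each of them is a neighbour of u or lies on an old hole K through u, and the rest of the new hole meets
-- no old hole through u. Hence the two arcs of K - u at a touch those at b, as otherwise an old hole
-- through u would meet the rest. Joining the arcs gives an old hole that avoids u and shares two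
-- consecutive edges with K, against the NC property. So no new holes appear, all edges added in step i
-- join C_i to its complement, and a clique of G_i* is a clique of G_{i-1}* together with a clique of G
-- inside C_i. Thus G lies in the chordal graph G_p*, a clique of which has at most (p + 1) ω(H) vertices
-- in an induced subgraph H of G, and greedy colouring along simplicial vertices applies.
--
-- Finding a hole is only shown not to be impossible (¬ ¬), which suffices because the existence of a
-- proper colouring is decidable.

private variable N : ℕ

-- Walks, induced paths and holes

-- `SG` puts no condition on its edges. These three survive every construction below and are assumed
-- throughout.
record IsSimple (F : SG N) : Set where
  field
    E-sym : ∀ {x y} → E F x y → E F y x
    E-irr : ∀ {x} → ¬ E F x x
    E⇒V   : ∀ {x y} → E F x y → V F x
open IsSimple public

Touch : SG N → Fin N → Fin N → Set
Touch F x y = x ≡ y ⊎ E F x y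

data Walk (F : SG N) (S : Fin N → Set) : Fin N → Fin N → Set where
  stop : ∀ {x} → S x → Walk F S x x
  step : ∀ {x y z} → S x → E F x y → Walk F S y z → Walk F S x z

-- The list omits the first vertex. Since `Touch` includes equality, the `All` condition rules out
-- repetitions as well as chords.
data InducedPath (F : SG N) (S : Fin N → Set) : Fin N → List (Fin N) → Fin N → Set where
  stop : ∀ {x} → S x → InducedPath F S x [] x
  step : ∀ {x y z ys} → S x → E F x y → All (λ v → ¬ Touch F x v) ys →
         InducedPath F S y ys z → InducedPath F S x (y ∷ ys) z

module _ {F : SG N} where

  walk-map : ∀ {S S′ : Fin N → Set} → (∀ {v} → S v → S′ v) → ∀ {x y} → Walk F S x y → Walk F S′ x y
  walk-map f (stop s)     = stop (f s)
  walk-map f (step s e w) = step (f s) e (walk-map f w)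

  walk-start : ∀ {S x y} → Walk F S x y → S x
  walk-start (stop s)     = s
  walk-start (step s _ _) = s

  walk-end : ∀ {S x y} → Walk F S x y → S y
  walk-end (stop s)     = s
  walk-end (step _ _ w) = walk-end w

  walk-trans : ∀ {S x y z} → Walk F S x y → Walk F S y z → Walk F S x z
  walk-trans (stop _)     w′ = w′
  walk-trans (step s e w) w′ = step s e (walk-trans w w′)

  walk-touch : ∀ {S x y} → S x → S y → Touch F x y → Walk F S x y
  walk-touch sx sy (inj₁ refl) = stop sx
  walk-touch sx sy (inj₂ e)    = step sx e (stop sy)

  walk-sym : IsSimple F → ∀ {S x y} → Walk F S x y → Walk F S y x
  walk-sym F-simple (stop s) = stop s
  walk-sym F-simple (step s e w) =
    walk-trans (walk-sym F-simple w) (step (walk-start w) (E-sym F-simple e) (stop s))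

  -- Cut the path at the last vertex that touches `x`. If this vertex is `x`, the remainder is
  -- already the path sought; otherwise `x` is attached to it.
  prepend : ∀ {S x y ys z} → S x → InducedPath F S y ys z → Any (Touch F x) (y ∷ ys) →
            ¬ ¬ ∃ λ zs → InducedPath F S x zs z
  prepend sx p@(stop _) (here (inj₁ refl)) k = k (_ , p)
  prepend sx p@(stop _) (here (inj₂ e))    k = k (_ , step sx e [] p)
  prepend {x = x} {ys = ys} sx p@(step _ _ _ q) t k = ¬¬-excluded-middle λ where
      (yes t′) → prepend sx q t′ k
      (no ¬t′) → case-head t ¬t′
    where
    case-head : Any (Touch F x) (_ ∷ ys) → ¬ Any (Touch F x) ys → ⊥
    case-head (there t′)       ¬t′ = ¬t′ t′
    case-head (here (inj₁ refl)) ¬t′ = k (_ , p)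
    case-head (here (inj₂ e))    ¬t′ = k (_ , step sx e (All.¬Any⇒All¬ _ ¬t′) p)

  straighten : ∀ {S x z} → Walk F S x z → ¬ ¬ ∃ λ zs → InducedPath F S x zs z
  straighten (stop s)     k = k (_ , stop s)
  straighten (step s e w) k =
    straighten w λ { (_ , p) → prepend s p (here (inj₂ e)) k }

  path-walk : ∀ {S T : Fin N → Set} {x xs z} → InducedPath F S x xs z → (∀ {v} → v ∈ x ∷ xs → T v) →
              Walk F (λ v → T v × S v) x z
  path-walk (stop s)       t = stop (t (here refl) , s)
  path-walk (step s e _ p) t = step (t (here refl) , s) e (path-walk p (t ∘ there))

  path-All : ∀ {S x xs z} → InducedPath F S x xs z → All S (x ∷ xs)
  path-All (stop s)       = s ∷ []
  path-All (step s _ _ p) = s ∷ path-All p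

  path-last : ∀ {S x xs z} → InducedPath F S x xs z → ∀ i → suc (toℕ i) ≡ length (x ∷ xs) →
              lookup (x ∷ xs) i ≡ z
  path-last (stop _)       zero    _  = refl
  path-last (step _ _ _ p) (suc i) eq = path-last p i (suc-injective eq)

  path-edge : ∀ {S x xs z} → InducedPath F S x xs z → ∀ i j → toℕ j ≡ suc (toℕ i) →
              E F (lookup (x ∷ xs) i) (lookup (x ∷ xs) j)
  path-edge (stop _)       zero    (suc ()) _
  path-edge (step _ e _ _) zero    (suc zero) _ = e
  path-edge (step _ _ _ p) (suc i) (suc j) eq = path-edge p i j (suc-injective eq)

  module _ (F-simple : IsSimple F) where

    path-V : ∀ {S x xs z} → V F z → InducedPath F S x xs z → All (V F) (x ∷ xs)
    path-V Vz (stop _)       = Vz ∷ []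
    path-V Vz (step _ e _ p) = E⇒V F-simple e ∷ path-V Vz p

    private
      no-touch : ∀ {x ys} → All (λ v → ¬ Touch F x v) ys → ∀ i → ¬ Touch F x (lookup ys i)
      no-touch a i = All.lookup a (∈-lookup i)

      step-fresh : ∀ {x y ys} → E F x y → All (λ v → ¬ Touch F x v) ys → ∀ j → x ≢ lookup (y ∷ ys) j
      step-fresh e a zero    refl = E-irr F-simple e
      step-fresh e a (suc j) eq   = no-touch a j (inj₁ eq)

    path-injective : ∀ {S x xs z} → InducedPath F S x xs z → ∀ i j →
                     lookup (x ∷ xs) i ≡ lookup (x ∷ xs) j → i ≡ j
    path-injective p              zero    zero    _  = refl
    path-injective (stop _)       zero    (suc ()) _
    path-injective (stop _)       (suc ()) _      _
    path-injective (step _ e a p) zero    (suc j) eq = ⊥-elim (step-fresh e a j eq)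
    path-injective (step _ e a p) (suc i) zero    eq = ⊥-elim (step-fresh e a i (sym eq))
    path-injective (step _ _ _ p) (suc i) (suc j) eq = cong suc (path-injective p i j eq)

    path-adjacent : ∀ {S x xs z} → InducedPath F S x xs z → ∀ i j →
                    E F (lookup (x ∷ xs) i) (lookup (x ∷ xs) j) →
                    toℕ j ≡ suc (toℕ i) ⊎ toℕ i ≡ suc (toℕ j)
    path-adjacent p              zero    zero    e = ⊥-elim (E-irr F-simple e)
    path-adjacent (stop _)       zero    (suc ()) _
    path-adjacent (stop _)       (suc ()) _      _
    path-adjacent (step _ _ a p) zero    (suc zero) e = inj₁ refl
    path-adjacent (step _ _ a p) zero    (suc (suc j)) e = ⊥-elim (no-touch a j (inj₂ e))
    path-adjacent (step _ _ a p) (suc zero) zero e = inj₂ refl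
    path-adjacent (step _ _ a p) (suc (suc i)) zero e = ⊥-elim (no-touch a i (inj₂ (E-sym F-simple e)))
    path-adjacent (step _ _ _ p) (suc i) (suc j) e with path-adjacent p i j e
    ... | inj₁ eq = inj₁ (cong suc eq)
    ... | inj₂ eq = inj₂ (cong suc eq)

    AvoidsNbrs : (S : Fin N → Set) (c y z : Fin N) → Set
    AvoidsNbrs S c y z = ∀ {v} → S v → v ≢ c × (E F c v → v ≡ y ⊎ v ≡ z)

    -- The vertex `c` closes the path to a cycle. It has no chord, because the path is induced and
    -- `c` has no neighbour in `S` other than the ends. As the ends are distinct and non-adjacent,
    -- the path has at least three vertices and the cycle has length at least 4. The two hole edges
    -- at `c` serve to detect shared consecutive edges, and the walk is the hole without `c`.
    path-hole : ∀ {S c y ys z} → E F c y → E F c z → y ≢ z → ¬ E F y z → AvoidsNbrs S c y z →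
                InducedPath F S y ys z →
                Σ (Hole F) λ K → HoleEdge K y c × HoleEdge K c z
                  × (∀ {v} → Contains K v → v ≡ c ⊎ S v)
                  × Walk F (λ v → Contains K v × S v) y z
    path-hole cy cz y≢z y≁z avoid (stop _) = ⊥-elim (y≢z refl)
    path-hole cy cz y≢z y≁z avoid (step _ e _ (stop _)) = ⊥-elim (y≁z e)
    path-hole {S} {c} {y} {ys} {z} cy cz y≢z y≁z avoid p@(step _ _ _ (step {ys = ys″} _ _ _ q)) =
      K , (suc zero , zero , inj₂ (inj₁ refl) , refl , refl)
        , (zero , suc last , inj₂ (inj₂ (inj₁ (refl , cong suc last-len))) , refl , last≡z)
        , contained
        , path-walk {T = Contains K} p (λ v∈l → suc (Any.index v∈l) , sym (lookup-index v∈l))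
      where
      l = y ∷ ys
      S-l : ∀ i → S (lookup l i)
      S-l i = All.lookup (path-All p) (∈-lookup i)
      last : Fin (length l)
      last = fromℕ (length ys)
      last-len : suc (toℕ last) ≡ length l
      last-len = cong suc (toℕ-fromℕ (length ys))
      last≡z : lookup l last ≡ z
      last≡z = path-last p last last-len

      c-adjacent : ∀ i → E F c (lookup l i) → toℕ i ≡ 0 ⊎ suc (toℕ i) ≡ length l
      c-adjacent i e with proj₂ (avoid (S-l i)) e
      ... | inj₁ eq = inj₁ (cong toℕ (path-injective p i zero eq))
      ... | inj₂ eq = inj₂ (trans (cong (suc ∘ toℕ) (path-injective p i last (trans eq (sym last≡z)))) last-len)

      -- Position 0 carries `c`, and position `suc i` carries the vertex `i` of the path.
      K : Hole F
      K .len = suc (length l)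
      K .len≥4 = s≤s (s≤s (s≤s (s≤s z≤n)))
      K .vs = lookup (c ∷ l)
      K .vs-inj {zero}  {zero}  eq = refl
      K .vs-inj {zero}  {suc j} eq = ⊥-elim (proj₁ (avoid (S-l j)) (sym eq))
      K .vs-inj {suc i} {zero}  eq = ⊥-elim (proj₁ (avoid (S-l i)) eq)
      K .vs-inj {suc i} {suc j} eq = cong suc (path-injective p i j eq)
      K .vs-V zero    = E⇒V F-simple cy
      K .vs-V (suc i) = All.lookup (path-V (E⇒V F-simple (E-sym F-simple cz)) p) (∈-lookup i)
      K .edge⇒ zero    zero    e = ⊥-elim (E-irr F-simple e)
      K .edge⇒ zero    (suc j) e with c-adjacent j e
      ... | inj₁ eq = inj₁ (cong suc eq)
      ... | inj₂ eq = inj₂ (inj₂ (inj₁ (refl , cong suc eq)))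
      K .edge⇒ (suc i) zero    e with c-adjacent i (E-sym F-simple e)
      ... | inj₁ eq = inj₂ (inj₁ (cong suc eq))
      ... | inj₂ eq = inj₂ (inj₂ (inj₂ (refl , cong suc eq)))
      K .edge⇒ (suc i) (suc j) e with path-adjacent p i j e
      ... | inj₁ eq = inj₁ (cong suc eq)
      ... | inj₂ eq = inj₂ (inj₁ (cong suc eq))
      K .⇒edge zero (suc zero) (inj₁ _) = cy
      K .⇒edge (suc i) (suc j) (inj₁ eq) = path-edge p i j (suc-injective eq)
      K .⇒edge (suc zero) zero (inj₂ (inj₁ _)) = E-sym F-simple cy
      K .⇒edge (suc i) (suc j) (inj₂ (inj₁ eq)) = E-sym F-simple (path-edge p j i (suc-injective eq))
      K .⇒edge (suc i) (suc j) (inj₂ (inj₂ (inj₁ (() , _))))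
      K .⇒edge (suc i) (suc j) (inj₂ (inj₂ (inj₂ (() , _))))
      K .⇒edge zero (suc j) (inj₂ (inj₂ (inj₁ (_ , eq)))) =
        subst (E F c) (sym (path-last p j (suc-injective eq))) cz
      K .⇒edge (suc i) zero (inj₂ (inj₂ (inj₂ (_ , eq)))) =
        E-sym F-simple (subst (E F c) (sym (path-last p i (suc-injective eq))) cz)

      contained : ∀ {v} → Contains K v → v ≡ c ⊎ S v
      contained (zero  , eq) = inj₁ (sym eq)
      contained (suc i , eq) = inj₂ (subst S eq (S-l i))

    walk-hole : ∀ {S c y z} → E F c y → E F c z → y ≢ z → ¬ E F y z → AvoidsNbrs S c y z →
                Walk F S y z →
                ¬ ¬ Σ (Hole F) λ K → HoleEdge K y c × HoleEdge K c z
                  × (∀ {v} → Contains K v → v ≡ c ⊎ S v)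
                  × Walk F (λ v → Contains K v × S v) y z
    walk-hole cy cz y≢z y≁z avoid w k =
      straighten w λ { (_ , p) → k (path-hole cy cz y≢z y≁z avoid p) }

-- Reading a hole cyclically from one of its vertices

module _ (n : ℕ) .{{_ : NonZero n}} where

  +-%-congˡ : ∀ c {a b} → a % n ≡ b % n → (c + a) % n ≡ (c + b) % n
  +-%-congˡ c {a} {b} eq = begin
    (c + a) % n             ≡⟨ %-distribˡ-+ c a n ⟩
    (c % n + a % n) % n     ≡⟨ cong (λ t → (c % n + t) % n) eq ⟩
    (c % n + b % n) % n     ≡⟨ %-distribˡ-+ c b n ⟨
    (c + b) % n             ∎
    where open ≡-Reasoning

  -- Here `n ∸ i` acts as the negative of `i` modulo `n`, which makes cancellation possible in the
  -- natural numbers.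
  ∸+-% : ∀ {i} → i ≤ n → ∀ a → (n ∸ i + (i + a)) % n ≡ a % n
  ∸+-% {i} i≤n a = begin
    (n ∸ i + (i + a)) % n   ≡⟨ cong (_% n) (+-assoc (n ∸ i) i a) ⟨
    (n ∸ i + i + a) % n     ≡⟨ cong (λ t → (t + a) % n) (m∸n+n≡m i≤n) ⟩
    (n + a) % n             ≡⟨ cong (_% n) (+-comm n a) ⟩
    (a + n) % n             ≡⟨ [m+n]%n≡m%n a n ⟩
    a % n                   ∎
    where open ≡-Reasoning

  +-%-cancelˡ : ∀ {i} → i ≤ n → ∀ {a b} → (i + a) % n ≡ (i + b) % n → a % n ≡ b % n
  +-%-cancelˡ {i} i≤n {a} {b} eq =
    trans (sym (∸+-% i≤n a)) (trans (+-%-congˡ (n ∸ i) eq) (∸+-% i≤n b))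

  Consec⇒% : ∀ {i j : Fin n} → Consec n i j → toℕ j ≡ suc (toℕ i) % n ⊎ toℕ i ≡ suc (toℕ j) % n
  Consec⇒% {i} {j} (inj₁ eq) =
    inj₁ (trans eq (sym (m<n⇒m%n≡m (subst (_< n) eq (toℕ<n j)))))
  Consec⇒% {i} {j} (inj₂ (inj₁ eq)) =
    inj₂ (trans eq (sym (m<n⇒m%n≡m (subst (_< n) eq (toℕ<n i)))))
  Consec⇒% (inj₂ (inj₂ (inj₁ (i≡0 , eq)))) =
    inj₂ (trans i≡0 (sym (trans (cong (_% n) eq) (n%n≡0 n))))
  Consec⇒% (inj₂ (inj₂ (inj₂ (j≡0 , eq)))) =
    inj₁ (trans j≡0 (sym (trans (cong (_% n) eq) (n%n≡0 n))))

  %⇒Consec : ∀ {i j : Fin n} → toℕ j ≡ suc (toℕ i) % n → Consec n i j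
  %⇒Consec {i} eq with m≤n⇒m<n∨m≡n (toℕ<n i)
  ... | inj₁ lt = inj₁ (trans eq (m<n⇒m%n≡m lt))
  ... | inj₂ wrap = inj₂ (inj₂ (inj₂ (trans eq (trans (cong (_% n) wrap) (n%n≡0 n)) , wrap)))

-- With `at k` the vertex `k` steps after `u`, arcs of the hole become intervals of natural numbers.
-- The cyclic wrap-around survives only in `at-wrap` and in the second case of `at-adjacent`.
record Rotation {F : SG N} (H : Hole F) (u : Fin N) : Set where
  field
    at          : ℕ → Fin N
    at-on       : ∀ k → Contains H (at k)
    at-zero     : at 0 ≡ u
    at-wrap     : at (len H) ≡ u
    at-onto     : ∀ {x} → Contains H x → ∃ λ k → k < len H × at k ≡ x
    at-step     : ∀ k → HoleEdge H (at k) (at (suc k))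
    at-inj      : ∀ {k l} → k < len H → l < len H → at k ≡ at l → k ≡ l
    at-adjacent : ∀ {k l} → k < l → l < len H → E F (at k) (at l) →
                  l ≡ suc k ⊎ (k ≡ 0 × suc l ≡ len H)

rotate : {F : SG N} (H : Hole F) {u : Fin N} → Contains H u → Rotation H u
rotate {F = F} H {u} (i₀ , vs-i₀) = record
  { at          = at
  ; at-on       = λ k → index k , refl
  ; at-zero     = trans (cong (vs H) (toℕ-injective (trans (toℕ-index 0)
                    (trans (cong (_% ℓ) (+-identityʳ (toℕ i₀))) i₀%n)))) vs-i₀
  ; at-wrap     = trans (cong (vs H) (toℕ-injective (trans (toℕ-index ℓ)
                    (trans ([m+n]%n≡m%n (toℕ i₀) ℓ) i₀%n)))) vs-i₀
  ; at-onto     = onto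
  ; at-step     = λ k → index k , index (suc k) , %⇒Consec ℓ (index-suc k) , refl , refl
  ; at-inj      = λ k<n l<n eq → small k<n l<n (index-cancel (cong toℕ (vs-inj H eq)))
  ; at-adjacent = adjacent
  }
  where
  ℓ = len H
  instance
    ℓ≢0 : NonZero ℓ
    ℓ≢0 = >-nonZero (≤-trans (s≤s z≤n) (len≥4 H))

  index : ℕ → Fin ℓ
  index k = fromℕ< (m%n<n (toℕ i₀ + k) ℓ)

  at : ℕ → Fin _
  at k = vs H (index k)

  toℕ-index : ∀ k → toℕ (index k) ≡ (toℕ i₀ + k) % ℓ
  toℕ-index k = toℕ-fromℕ< _

  i₀%n : toℕ i₀ % ℓ ≡ toℕ i₀
  i₀%n = m<n⇒m%n≡m (toℕ<n i₀)

  i₀≤n : toℕ i₀ ≤ ℓ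
  i₀≤n = <⇒≤ (toℕ<n i₀)

  suc-% : ∀ k → suc (toℕ (index k)) % ℓ ≡ (toℕ i₀ + suc k) % ℓ
  suc-% k = begin
    suc (toℕ (index k)) % ℓ       ≡⟨ cong (λ t → suc t % ℓ) (toℕ-index k) ⟩
    (1 + (toℕ i₀ + k) % ℓ) % ℓ    ≡⟨ +-%-congˡ ℓ 1 (m%n%n≡m%n (toℕ i₀ + k) ℓ) ⟩
    suc (toℕ i₀ + k) % ℓ          ≡⟨ cong (_% ℓ) (+-suc (toℕ i₀) k) ⟨
    (toℕ i₀ + suc k) % ℓ          ∎
    where open ≡-Reasoning

  index-suc : ∀ k → toℕ (index (suc k)) ≡ suc (toℕ (index k)) % ℓ
  index-suc k = trans (toℕ-index (suc k)) (sym (suc-% k))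

  index-cancel : ∀ {k l} → toℕ (index k) ≡ toℕ (index l) → k % ℓ ≡ l % ℓ
  index-cancel {k} {l} eq =
    +-%-cancelˡ ℓ i₀≤n (trans (sym (toℕ-index k)) (trans eq (toℕ-index l)))

  index-successor : ∀ {k l} → toℕ (index l) ≡ suc (toℕ (index k)) % ℓ → l % ℓ ≡ suc k % ℓ
  index-successor {k} eq = index-cancel (trans eq (sym (index-suc k)))

  small : ∀ {k l} → k < ℓ → l < ℓ → k % ℓ ≡ l % ℓ → k ≡ l
  small k<n l<n eq = trans (sym (m<n⇒m%n≡m k<n)) (trans eq (m<n⇒m%n≡m l<n))

  onto : ∀ {x} → Contains H x → ∃ λ k → k < ℓ × at k ≡ x
  -- The witness is `j` minus `i₀` modulo `ℓ`.
  onto (j , vs-j) = (ℓ ∸ toℕ i₀ + toℕ j) % ℓ , m%n<n _ ℓ ,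
    trans (cong (vs H) (toℕ-injective (trans (toℕ-index _) eq))) vs-j
    where
    open ≡-Reasoning
    eq : (toℕ i₀ + (ℓ ∸ toℕ i₀ + toℕ j) % ℓ) % ℓ ≡ toℕ j
    eq = begin
      (toℕ i₀ + (ℓ ∸ toℕ i₀ + toℕ j) % ℓ) % ℓ  ≡⟨ +-%-congˡ ℓ (toℕ i₀) (m%n%n≡m%n _ ℓ) ⟩
      (toℕ i₀ + (ℓ ∸ toℕ i₀ + toℕ j)) % ℓ      ≡⟨ cong (_% ℓ) (+-assoc (toℕ i₀) _ _) ⟨
      (toℕ i₀ + (ℓ ∸ toℕ i₀) + toℕ j) % ℓ      ≡⟨ cong (λ t → (t + toℕ j) % ℓ) (+-comm (toℕ i₀) _) ⟩
      (ℓ ∸ toℕ i₀ + toℕ i₀ + toℕ j) % ℓ        ≡⟨ cong (_% ℓ) (+-assoc (ℓ ∸ toℕ i₀) _ _) ⟩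
      (ℓ ∸ toℕ i₀ + (toℕ i₀ + toℕ j)) % ℓ      ≡⟨ ∸+-% ℓ i₀≤n (toℕ j) ⟩
      toℕ j % ℓ                                ≡⟨ m<n⇒m%n≡m (toℕ<n j) ⟩
      toℕ j                                    ∎

  adjacent : ∀ {k l} → k < l → l < ℓ → E F (at k) (at l) → l ≡ suc k ⊎ (k ≡ 0 × suc l ≡ ℓ)
  adjacent {k} {l} k<l l<n e with Consec⇒% ℓ {index k} {index l} (edge⇒ H (index k) (index l) e)
  ... | inj₁ eq = inj₁ (small l<n (≤-trans (s≤s k<l) l<n) (index-successor {k} {l} eq))
  -- Now `k` is `suc l` modulo `ℓ`, which together with `k < l` forces the wrap-around.
  ... | inj₂ eq with m≤n⇒m<n∨m≡n l<n
  ...   | inj₂ wrap = inj₂ (k≡0 , wrap)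
    where
    k≡0 : k ≡ 0
    k≡0 = trans (sym (m<n⇒m%n≡m (<-trans k<l l<n)))
            (trans (index-successor {l} {k} eq) (trans (cong (_% ℓ) wrap) (n%n≡0 ℓ)))
  ...   | inj₁ l+1<n = ⊥-elim (<⇒≢ (m<n⇒m<1+n k<l)
            (small (<-trans k<l l<n) l+1<n (index-successor {l} {k} eq)))

-- Holes of a locally chordalized graph

<⇒∃suc : ∀ {m n} → m < n → ∃ λ k → n ≡ suc k
<⇒∃suc (s≤s _) = _ , refl

touch-sym : {F : SG N} → IsSimple F → ∀ {x y} → Touch F x y → Touch F y x
touch-sym F-simple (inj₁ eq) = inj₁ (sym eq)
touch-sym F-simple (inj₂ e)  = inj₂ (E-sym F-simple e)

-- Take the first step into a vertex labelled `B`. If there is none, the end of the walk lies in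
-- both sets and touches itself.
crossing : {F : SG N} {A B : Fin N → Set} {x y : Fin N} → A x → B y →
           Walk F (λ v → A v ⊎ B v) x y → ∃₂ λ s t → A s × B t × Touch F s t
crossing ax by (stop _) = _ , _ , ax , by , inj₁ refl
crossing ax by (step _ e w) with walk-start w
... | inj₁ az = crossing az by w
... | inj₂ bz = _ , _ , ax , bz , inj₂ e

module Arcs {F : SG N} (F-simple : IsSimple F) {H : Hole F} {u : Fin N} (R : Rotation H u) where
  open Rotation R public

  Arc : ℕ → ℕ → Fin N → Set
  Arc lo hi v = ∃ λ k → lo ≤ k × k ≤ hi × at k ≡ v

  at-edge : ∀ k → E F (at k) (at (suc k))
  at-edge k with at-step k
  ... | i , j , c , eq₁ , eq₂ = subst₂ (E F) eq₁ eq₂ (⇒edge H i j c)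

  arc-walk : ∀ {lo hi i j} → lo ≤ i → i ≤′ j → j ≤ hi → Walk F (Arc lo hi) (at i) (at j)
  arc-walk lo≤i ≤′-refl j≤hi = stop (_ , lo≤i , j≤hi , refl)
  arc-walk {j = suc j} lo≤i (≤′-step i≤j) j<hi =
    walk-trans (arc-walk lo≤i i≤j j≤hi)
      (step (j , lo≤j , j≤hi , refl) (at-edge j) (stop (suc j , m≤n⇒m≤1+n lo≤j , j<hi , refl)))
    where
    j≤hi = <⇒≤ j<hi
    lo≤j = ≤-trans lo≤i (≤′⇒≤ i≤j)

  arc-connected : ∀ {lo hi v w} → Arc lo hi v → Arc lo hi w → Walk F (Arc lo hi) v w
  arc-connected (i , lo≤i , i≤hi , refl) (j , lo≤j , j≤hi , refl) with ≤-total i j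
  ... | inj₁ i≤j = arc-walk lo≤i (≤⇒≤′ i≤j) j≤hi
  ... | inj₂ j≤i = walk-sym F-simple (arc-walk lo≤j (≤⇒≤′ j≤i) i≤hi)

  at≢ : ∀ {k} → 0 < k → k < len H → at k ≢ u
  at≢ 0<k k<len eq =
    <⇒≢ 0<k (at-inj (≤-trans (s≤s z≤n) k<len) k<len (trans at-zero (sym eq)))

  u-adjacent : ∀ {k} → 0 < k → k < len H → E F u (at k) → k ≡ 1 ⊎ suc k ≡ len H
  u-adjacent 0<k k<len e with at-adjacent 0<k k<len (subst (λ x → E F x _) (sym at-zero) e)
  ... | inj₁ k≡1      = inj₁ k≡1
  ... | inj₂ (_ , eq) = inj₂ eq

  u-first : E F u (at 1)
  u-first = subst (λ x → E F x (at 1)) at-zero (at-edge 0)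

  u-last : ∀ {k} → suc k ≡ len H → E F u (at k)
  u-last {k} eq = E-sym F-simple (subst (E F (at k)) (trans (cong at eq) at-wrap) (at-edge k))

-- Arms, links and pinching at the chordalizing vertex

module _ {F : SG N} (F-simple : IsSimple F) (u : Fin N) where

  -- An arm leads from `a` to the neighbourhood of `u`. It is `a` alone if `a` is adjacent to `u`,
  -- and otherwise an arc, without `u`, of an old hole through both. Having a single neighbour of
  -- `u` in each arm is what allows two arms to close up to a hole at `u`.
  record Arm (a : Fin N) (A : Fin N → Set) : Set where
    field
      base      : A a
      root      : Fin N
      root∈     : A root
      root-nbr  : E F u root
      only-root : ∀ {v} → A v → v ≢ u × (E F u v → v ≡ root)
      connected : ∀ {v w} → A v → A w → Walk F A v w

  -- This records what a new hole through `u` leaves behind in the old graph: `a` and `b` are the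
  -- neighbours of `u` on it and `X` is the rest.
  record Linked (a b : Fin N) : Set₁ where
    field
      X       : Fin N → Set
      X-far   : ∀ {v} → X v → v ≢ u × ¬ E F u v
      X-clear : ∀ (K : Hole F) {v} → Contains K u → Contains K v → ¬ X v
      link    : Walk F (λ v → v ≡ a ⊎ v ≡ b ⊎ X v) a b

  open Arm
  open Linked

  linked-sym : ∀ {a b} → Linked a b → Linked b a
  linked-sym L = record
    { X = X L ; X-far = X-far L ; X-clear = X-clear L
    ; link = walk-map (λ { (inj₁ eq) → inj₂ (inj₁ eq) ; (inj₂ (inj₁ eq)) → inj₁ eq
                         ; (inj₂ (inj₂ x)) → inj₂ (inj₂ x) }) (walk-sym F-simple (link L)) }

  single : ∀ {a} → E F u a → Arm a (_≡ a)
  single e = record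
    { base = refl ; root = _ ; root∈ = refl ; root-nbr = e
    ; only-root = λ { refl → (λ { refl → E-irr F-simple e }) , λ _ → refl }
    ; connected = λ { refl refl → stop refl } }

  -- Otherwise the two arms, joined through X, would close up to a hole through u meeting X.
  arms-touch : ∀ {a b A B} → Arm a A → Arm b B → Linked a b →
               ¬ ¬ ∃₂ λ s t → A s × B t × Touch F s t
  arms-touch {a} {b} {A} {B} armA armB L k =
    walk-hole F-simple (root-nbr armA) (root-nbr armB)
      (λ eq → k (_ , _ , root∈ armA , root∈ armB , inj₁ eq))
      (λ e → k (_ , _ , root∈ armA , root∈ armB , inj₂ e))
      avoid walk
      λ { (K , (_ , j , _ , _ , j≡u) , _ , _ , w) →
          k (crossing (root∈ armA) (root∈ armB) (walk-map (λ { (K∋v , s) → outside K (j , j≡u) K∋v s }) w)) }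
    where
    S : Fin N → Set
    S v = A v ⊎ B v ⊎ X L v

    avoid : AvoidsNbrs F-simple S u (root armA) (root armB)
    avoid (inj₁ av)        = proj₁ (only-root armA av) , inj₁ ∘ proj₂ (only-root armA av)
    avoid (inj₂ (inj₁ bv)) = proj₁ (only-root armB bv) , inj₂ ∘ proj₂ (only-root armB bv)
    avoid (inj₂ (inj₂ xv)) = proj₁ (X-far L xv) , ⊥-elim ∘ proj₂ (X-far L xv)

    walk : Walk F S (root armA) (root armB)
    walk = walk-trans (walk-map inj₁ (connected armA (root∈ armA) (base armA)))
          (walk-trans (walk-map (λ { (inj₁ refl) → inj₁ (base armA)
                                   ; (inj₂ (inj₁ refl)) → inj₂ (inj₁ (base armB))
                                   ; (inj₂ (inj₂ xv)) → inj₂ (inj₂ xv) }) (link L))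
                      (walk-map (inj₂ ∘ inj₁) (connected armB (base armB) (root∈ armB))))

    outside : ∀ (K : Hole F) {v} → Contains K u → Contains K v → S v → A v ⊎ B v
    outside K K∋u K∋v (inj₁ av)        = inj₁ av
    outside K K∋u K∋v (inj₂ (inj₁ bv)) = inj₂ bv
    outside K K∋u K∋v (inj₂ (inj₂ xv)) = ⊥-elim (X-clear L K K∋u K∋v xv)

  -- An old hole with `u` at position 0, `a` at position `suc pre` and last position `top`. The
  -- bounds leave a further vertex on either side of `a`, so that both neighbours of `a` on the hole
  -- differ from `u`.
  record Opposite (a : Fin N) : Set where
    field
      H      : Hole F
      R      : Rotation H u
      pre    : ℕ
      0<pre  : 0 < pre
      at-a   : Rotation.at R (suc pre) ≡ a
      top    : ℕ
      len≡   : len H ≡ suc top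
      post≤  : suc (suc pre) ≤ top

  opposite : ∀ {a} (H : Hole F) → Contains H u → Contains H a → a ≢ u → ¬ E F u a → Opposite a
  opposite {a} H H∋u H∋a a≢u ¬ua = go (at-onto H∋a)
    where
    R = rotate H H∋u
    open Arcs F-simple R
    go : (∃ λ k → k < len H × at k ≡ a) → Opposite a
    go (zero , _ , eq) = ⊥-elim (a≢u (trans (sym eq) at-zero))
    go (suc zero , _ , eq) = ⊥-elim (¬ua (subst (E F u) eq u-first))
    go (suc (suc k) , k<len , eq) with m≤n⇒m<n∨m≡n k<len
    ... | inj₂ end = ⊥-elim (¬ua (subst (E F u) eq (u-last end)))
    ... | inj₁ lt with <⇒∃suc lt
    ...   | top , len≡ = record { H = H ; R = R ; pre = suc k ; 0<pre = s≤s z≤n ; at-a = eq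
                                ; top = top ; len≡ = len≡ ; post≤ = ≤-pred (subst (_ ≤_) len≡ lt) }

  module Around {a : Fin N} (P : Opposite a) where
    open Opposite P
    open Arcs F-simple R

    <len : ∀ {k} → k ≤ top → k < len H
    <len k≤top = subst (_ <_) (sym len≡) (s≤s k≤top)

    Near Far : Fin N → Set
    Near = Arc 1 (suc pre)
    Far  = Arc (suc pre) top

    near : Arm a Near
    near = record
      { base = suc pre , s≤s z≤n , ≤-refl , at-a
      ; root = at 1 ; root∈ = 1 , ≤-refl , s≤s z≤n , refl ; root-nbr = u-first
      ; only-root = λ { (k , 1≤k , k≤ , refl) →
          let k<top = ≤-trans (s≤s k≤) post≤ ; k<len = <len (<⇒≤ k<top) in
          at≢ 1≤k k<len , λ e → [ cong at , (λ eq → ⊥-elim (<⇒≢ k<top (suc-injective (trans eq len≡)))) ]′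
                                 (u-adjacent 1≤k k<len e) }
      ; connected = arc-connected }

    far : Arm a Far
    far = record
      { base = suc pre , ≤-refl , <⇒≤ post≤ , at-a
      ; root = at top ; root∈ = top , <⇒≤ post≤ , ≤-refl , refl ; root-nbr = u-last (sym len≡)
      ; only-root = λ { (k , <k , k≤ , refl) →
          let k<len = <len k≤ ; 1<k = ≤-trans (s≤s 0<pre) <k ; 0<k = <⇒≤ 1<k in
          at≢ 0<k k<len , λ e → [ (λ eq → ⊥-elim (<⇒≢ 1<k (sym eq))) , (λ eq → cong at (suc-injective (trans eq len≡))) ]′
                                 (u-adjacent 0<k k<len e) }
      ; connected = arc-connected }

    -- The hole found in the proof passes through a and its two neighbours on H, but not through u.
    pinch : NCvertex F u → {Q : Fin N → Set} → (∀ {v} → Q v → v ≢ u × v ≢ a × ¬ E F a v) →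
            ∀ {q₁ q₂ s₁ s₂} → Walk F Q q₁ q₂ →
            Near s₁ → s₁ ≢ a → Touch F s₁ q₁ → Far s₂ → s₂ ≢ a → Touch F s₂ q₂ → ⊥
    pinch nc {Q} Q-clear {q₁} {q₂} {s₁} {s₂} wQ near₁ s₁≢a t₁ far₂ s₂≢a t₂ =
      walk-hole F-simple (E-sym F-simple pa) ap p₁≢p₂ p₁≁p₂ avoid walk
        λ { (K , e₁ , e₂ , inside , _) →
            nc H K (subst (Contains H) at-zero (at-on 0)) (avoids-u ∘ inside)
              (at pre , a , at post , p₁≢p₂
              , subst (HoleEdge H (at pre)) at-a (at-step pre)
              , subst (λ x → HoleEdge H x (at post)) at-a (at-step (suc pre)) , e₁ , e₂) }
      where
      post = suc (suc pre)
      S : Fin N → Set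
      S v = Arc 1 pre v ⊎ Q v ⊎ Arc post top v

      pa : E F (at pre) a
      pa = subst (E F (at pre)) at-a (at-edge pre)
      ap : E F a (at post)
      ap = subst (λ x → E F x (at post)) at-a (at-edge (suc pre))
      mid<top : suc pre < top
      mid<top = post≤
      pre<top : pre < top
      pre<top = <⇒≤ post≤
      p₁≢p₂ : at pre ≢ at post
      p₁≢p₂ eq = <⇒≢ (m<n⇒m<1+n ≤-refl) (at-inj (<len (<⇒≤ pre<top)) (<len post≤) eq)
      p₁≁p₂ : ¬ E F (at pre) (at post)
      p₁≁p₂ e with at-adjacent (m<n⇒m<1+n ≤-refl) (<len post≤) e
      ... | inj₁ eq = <⇒≢ ≤-refl (sym (suc-injective eq))
      ... | inj₂ (eq , _) = <⇒≢ 0<pre (sym eq)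

      before : ∀ {k} → k ≤ pre → at k ≢ a
      before k≤pre eq = <⇒≢ (s≤s k≤pre)
        (at-inj (<len (≤-trans k≤pre (<⇒≤ pre<top))) (<len (<⇒≤ mid<top)) (trans eq (sym at-a)))
      after : ∀ {k} → post ≤ k → k ≤ top → at k ≢ a
      after post≤k k≤top eq = <⇒≢ post≤k
        (at-inj (<len (<⇒≤ mid<top)) (<len k≤top) (trans at-a (sym eq)))

      avoid : AvoidsNbrs F-simple S a (at pre) (at post)
      avoid (inj₁ (k , 1≤k , k≤pre , refl)) = before k≤pre , λ e →
        [ (λ eq → inj₁ (cong at (sym (suc-injective eq)))) , (λ { (eq , _) → ⊥-elim (<⇒≢ 1≤k (sym eq)) }) ]′
        (at-adjacent (s≤s k≤pre) (<len (<⇒≤ mid<top))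
          (subst (E F (at k)) (sym at-a) (E-sym F-simple e)))
      avoid (inj₂ (inj₁ qv)) = proj₁ (proj₂ (Q-clear qv)) , ⊥-elim ∘ proj₂ (proj₂ (Q-clear qv))
      avoid (inj₂ (inj₂ (k , post≤k , k≤top , refl))) = after post≤k k≤top , λ e →
        [ (λ eq → inj₂ (cong at eq)) , (λ { (() , _) }) ]′
        (at-adjacent post≤k (<len k≤top) (subst (λ x → E F x (at k)) (sym at-a) e))

      avoids-u : ¬ (u ≡ a ⊎ S u)
      avoids-u (inj₁ eq) = at≢ (s≤s z≤n) (<len (<⇒≤ mid<top)) (trans at-a (sym eq))
      avoids-u (inj₂ (inj₁ (k , 1≤k , k≤pre , eq))) = at≢ 1≤k (<len (≤-trans k≤pre (<⇒≤ pre<top))) eq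
      avoids-u (inj₂ (inj₂ (inj₁ qu))) = proj₁ (Q-clear qu) refl
      avoids-u (inj₂ (inj₂ (inj₂ (k , post≤k , k≤top , eq)))) =
        at≢ (≤-trans (s≤s z≤n) post≤k) (<len k≤top) eq

      s₁-arc : Near s₁ → Arc 1 pre s₁
      s₁-arc (k , 1≤k , k≤ , eq) with m≤n⇒m<n∨m≡n k≤
      ... | inj₁ lt   = k , 1≤k , ≤-pred lt , eq
      ... | inj₂ refl = ⊥-elim (s₁≢a (trans (sym eq) at-a))
      s₂-arc : Far s₂ → Arc post top s₂
      s₂-arc (k , <k , k≤ , eq) with m≤n⇒m<n∨m≡n <k
      ... | inj₁ lt   = k , lt , k≤ , eq
      ... | inj₂ refl = ⊥-elim (s₂≢a (trans (sym eq) at-a))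

      walk : Walk F S (at pre) (at post)
      walk =
        walk-trans (walk-map inj₁ (arc-connected (pre , 0<pre , ≤-refl , refl) (s₁-arc near₁)))
        (walk-trans (walk-touch (inj₁ (s₁-arc near₁)) (inj₂ (inj₁ (walk-start wQ))) t₁)
        (walk-trans (walk-map (inj₂ ∘ inj₁) wQ)
        (walk-trans (walk-touch (inj₂ (inj₁ (walk-end wQ))) (inj₂ (inj₂ (s₂-arc far₂))) (touch-sym F-simple t₂))
                    (walk-map (inj₂ ∘ inj₂) (arc-connected (s₂-arc far₂) (post , ≤-refl , post≤ , refl))))))

  open Around

  module _ (nc : NCvertex F u) where

    pinch-vertex : ∀ {a b} (P : Opposite a) → ¬ Touch F a b → b ≢ u →
                   (∃ λ s → Near P s × Touch F s b) → (∃ λ s → Far P s × Touch F s b) → ⊥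
    pinch-vertex {a} {b} P a-b b≢u (s₁ , n₁ , t₁) (s₂ , f₂ , t₂) =
      pinch P nc {Q = _≡ b} (λ { refl → b≢u , (λ eq → a-b (inj₁ (sym eq))) , a-b ∘ inj₂ })
        (stop refl) n₁ (λ { refl → a-b t₁ }) t₁ f₂ (λ { refl → a-b t₂ }) t₂

    -- By `arms-touch` the arm meets or is adjacent to both arcs at `b`. If it misses `b` itself, it
    -- is a connected bridge between them as `pinch` requires.
    pinch-arm : ∀ {a b A} → Arm a A → (P : Opposite b) → Linked a b →
                ¬ (∃ λ s → A s × Touch F s b) → ⊥
    pinch-arm {a} {b} {A} arm P L misses =
      arms-touch arm (near P) L λ { (s₁ , t₁ , a₁ , n₁ , s₁-t₁) →
      arms-touch arm (far P)  L λ { (s₂ , t₂ , a₂ , f₂ , s₂-t₂) →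
      pinch P nc {Q = A}
        (λ av → proj₁ (only-root arm av) , (λ { refl → misses (_ , av , inj₁ refl) })
              , λ e → misses (_ , av , inj₂ (E-sym F-simple e)))
        (connected arm a₁ a₂)
        n₁ (λ { refl → misses (_ , a₁ , s₁-t₁) }) (touch-sym F-simple s₁-t₁)
        f₂ (λ { refl → misses (_ , a₂ , s₂-t₂) }) (touch-sym F-simple s₂-t₂) } }

    arm-touches-nbr : ∀ {a b A} → Arm a A → E F u b → Linked a b → ¬ ¬ ∃ λ s → A s × Touch F s b
    arm-touches-nbr arm ub L k = arms-touch arm (single ub) L λ { (s , _ , as , refl , t) → k (s , as , t) }

    -- If both vertices are neighbours of `u`, they are arms themselves and would touch. If `a` is
    -- opposite, both its arcs touch `b`: through `arm-touches-nbr` when `b` is a neighbour of `u`,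
    -- and through `pinch-arm` when it is opposite. Then `b` alone bridges the arcs.
    not-linked : ∀ {a b} → ¬ Touch F a b → a ≢ u → b ≢ u →
                 E F u a ⊎ Opposite a → E F u b ⊎ Opposite b → ¬ Linked a b
    not-linked a-b a≢u b≢u (inj₁ ua) (inj₁ ub) L =
      arm-touches-nbr (single ua) ub L λ { (_ , refl , t) → a-b t }
    not-linked a-b a≢u b≢u (inj₂ P) (inj₁ ub) L =
      arm-touches-nbr (near P) ub L λ t₁ →
      arm-touches-nbr (far P)  ub L λ t₂ →
      pinch-vertex P a-b b≢u t₁ t₂
    not-linked a-b a≢u b≢u (inj₁ ua) (inj₂ P) L =
      not-linked (a-b ∘ touch-sym F-simple) b≢u a≢u (inj₂ P) (inj₁ ua) (linked-sym L)
    not-linked a-b a≢u b≢u (inj₂ P) (inj₂ P′) L =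
      ¬¬-excluded-middle λ where
        (no ¬t₁) → pinch-arm (near P) P′ L ¬t₁
        (yes t₁) → ¬¬-excluded-middle λ where
          (no ¬t₂) → pinch-arm (far P) P′ L ¬t₂
          (yes t₂) → pinch-vertex P a-b b≢u t₁ t₂

-- Chordalizing at one vertex creates no hole through it

chordalize-simple : {F : SG N} → IsSimple F → ∀ u → IsSimple (chordalize F u)
chordalize-simple {F = F} F-simple u = record
  { E-sym = λ { (inj₁ e) → inj₁ (E-sym F-simple e)
              ; (inj₂ (x≢y , H , H∋x , H∋y , eq)) →
                  inj₂ (≢-sym x≢y , H , H∋y , H∋x , [ inj₂ , inj₁ ]′ eq) }
  ; E-irr = λ { (inj₁ e) → E-irr F-simple e ; (inj₂ (x≢x , _)) → x≢x refl }
  ; E⇒V   = λ { (inj₁ e) → E⇒V F-simple e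
              ; (inj₂ (_ , H , (i , eq) , _)) → subst (V F) eq (vs-V H i) } }

chordalize-old : {F : SG N} {u x y : Fin N} → x ≢ u → y ≢ u → E (chordalize F u) x y → E F x y
chordalize-old x≢u y≢u (inj₁ e) = e
chordalize-old x≢u y≢u (inj₂ (_ , _ , _ , _ , inj₁ x≡u)) = ⊥-elim (x≢u x≡u)
chordalize-old x≢u y≢u (inj₂ (_ , _ , _ , _ , inj₂ y≡u)) = ⊥-elim (y≢u y≡u)

chordalize-hole-avoids : {F : SG N} {u : Fin N} → IsSimple F → NCvertex F u →
                         (H : Hole (chordalize F u)) → ¬ Contains H u
chordalize-hole-avoids {F = F} {u = u} F-simple nc H H∋u =
  -- The goal is absurdity, so it may be asked whether the edges from `u` to `a` and `b` are old or
  -- new.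
  ¬¬-excluded-middle λ ua? → ¬¬-excluded-middle λ ub? →
  not-linked F-simple u nc a-b a≢u b≢u (anchor a≢u ua? u-first) (anchor b≢u ub? (u-last (sym len≡))) linked
  where
  F′ = chordalize F u
  F′-simple = chordalize-simple F-simple u
  open Arcs F′-simple (rotate H H∋u)
  -- Positions on the new hole: `u` at 0, `a` at 1, the rest `X₀` from 2 to `top`, and `b` at
  -- `last`, which is `suc top`.
  shape : ∃ λ t → len H ≡ suc (suc t)
  shape = let m , len≡suc = <⇒∃suc (len≥4 H)
              t , m≡suc   = <⇒∃suc (≤-pred (subst (2 ≤_) len≡suc (≤-trans (s≤s (s≤s z≤n)) (len≥4 H))))
          in t , trans len≡suc (cong suc m≡suc)
  top = proj₁ shape
  len≡ = proj₂ shape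
  2≤top : 2 ≤ top
  2≤top = ≤-pred (≤-pred (subst (4 ≤_) len≡ (len≥4 H)))
  last = suc top
  a = at 1
  b = at last
  <len : ∀ {k} → k ≤ last → k < len H
  <len k≤ = subst (_ <_) (sym len≡) (s≤s k≤)
  a≢u : a ≢ u
  a≢u = at≢ ≤-refl (<len (s≤s z≤n))
  b≢u : b ≢ u
  b≢u = at≢ (s≤s z≤n) (<len ≤-refl)

  a-b : ¬ Touch F a b
  a-b (inj₁ eq) = <⇒≢ (≤-trans (s≤s z≤n) 2≤top) (suc-injective (at-inj (<len (s≤s z≤n)) (<len ≤-refl) eq))
  a-b (inj₂ e) with at-adjacent (s≤s (≤-trans (s≤s z≤n) 2≤top)) (<len ≤-refl) (inj₁ e)
  ... | inj₁ eq = <⇒≢ 2≤top (sym (suc-injective eq))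
  ... | inj₂ (() , _)

  anchor : ∀ {x} → x ≢ u → Dec (E F u x) → E F′ u x → E F u x ⊎ Opposite F-simple u x
  anchor x≢u (yes ux) _ = inj₁ ux
  anchor x≢u (no ¬ux) (inj₁ ux) = inj₁ ux
  anchor x≢u (no ¬ux) (inj₂ (_ , K , K∋u , K∋x , _)) = inj₂ (opposite F-simple u K K∋u K∋x x≢u ¬ux)

  X₀ : Fin _ → Set
  X₀ = Arc 2 top

  X₀-far : ∀ {v} → X₀ v → v ≢ u × ¬ E F′ u v
  X₀-far (k , 2≤k , k≤top , refl) = at≢ (<⇒≤ 2≤k) k<len , λ e →
    [ (λ eq → <⇒≢ 2≤k (sym eq)) , (λ eq → <⇒≢ (s≤s k≤top) (suc-injective (trans eq len≡))) ]′
    (u-adjacent (<⇒≤ 2≤k) k<len e)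
    where k<len = <len (m≤n⇒m≤1+n k≤top)

  locate : ∀ {v} → Arc 1 last v → v ≡ a ⊎ v ≡ b ⊎ X₀ v
  locate (k , 1≤k , k≤last , refl) with m≤n⇒m<n∨m≡n 1≤k | m≤n⇒m<n∨m≡n k≤last
  ... | inj₂ refl | _         = inj₁ refl
  ... | inj₁ 2≤k  | inj₂ refl = inj₂ (inj₁ refl)
  ... | inj₁ 2≤k  | inj₁ lt   = inj₂ (inj₂ (k , 2≤k , ≤-pred lt , refl))

  restrict : ∀ {S x y} → (∀ {v} → S v → v ≢ u) → Walk F′ S x y → Walk F S x y
  restrict ∌u (stop s)     = stop s
  restrict ∌u (step s e w) = step s (chordalize-old (∌u s) (∌u (walk-start w)) e) (restrict ∌u w)

  linked : Linked F-simple u a b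
  linked = record
    { X       = X₀
    ; X-far   = λ x → proj₁ (X₀-far x) , proj₂ (X₀-far x) ∘ inj₁
    -- A vertex on an old hole through `u` has been joined to `u`, which would be a chord of the new
    -- hole.
    ; X-clear = λ K K∋u K∋v x → proj₂ (X₀-far x) (inj₂ (≢-sym (proj₁ (X₀-far x)) , K , K∋u , K∋v , inj₁ refl))
    ; link    = walk-map locate (restrict
        (λ { (k , 1≤k , k≤ , refl) → at≢ 1≤k (<len k≤) })
        (arc-connected (1 , ≤-refl , s≤s z≤n , refl) (last , s≤s z≤n , ≤-refl , refl)))
    }

-- Cliques in the chordal completion

-- All added edges end at `u`, so a hole that avoids `u` consists of old edges.
chordalize-hole : {F : SG N} {u : Fin N} → IsSimple F → NCvertex F u → Hole (chordalize F u) → Hole F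
chordalize-hole F-simple nc H = record
  { len    = len H
  ; len≥4  = len≥4 H
  ; vs     = vs H
  ; vs-inj = vs-inj H
  ; vs-V   = vs-V H
  ; edge⇒  = λ i j e → edge⇒ H i j (inj₁ e)
  ; ⇒edge  = λ i j c → chordalize-old (avoids i) (avoids j) (⇒edge H i j c)
  }
  where
  avoids : ∀ i → vs H i ≢ _
  avoids i eq = chordalize-hole-avoids F-simple nc H (i , eq)

-- The NC property speaks only of holes, and by `chordalize-hole` these are old holes on the same
-- vertices. This carries the property through the successive steps of `hat`.
chordalize-NCset : {F : SG N} {u : Fin N} {C : List (Fin N)} → IsSimple F → u ∈ C →
                   NCset F C → NCset (chordalize F u) C
chordalize-NCset {F = F} {u = u} F-simple u∈C (nc , one) =
  (λ v v∈C H₁ H₂ → nc v v∈C (old H₁) (old H₂)) , one ∘ old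
  where
  old : Hole (chordalize F u) → Hole F
  old = chordalize-hole F-simple (nc u u∈C)

hat-simple : {F : SG N} → IsSimple F → ∀ us → IsSimple (hat F us)
hat-simple F-simple []       = F-simple
hat-simple F-simple (u ∷ us) = hat-simple (chordalize-simple F-simple u) us

hat-V : (F : SG N) → ∀ us → V (hat F us) ≡ V F
hat-V F []       = refl
hat-V F (u ∷ us) = hat-V (chordalize F u) us

hat-mono : {F : SG N} → ∀ us {x y} → E F x y → E (hat F us) x y
hat-mono []       e = e
hat-mono (u ∷ us) e = hat-mono us (inj₁ e)

hat-outside : {F : SG N} → ∀ us {x y} → ¬ x ∈ us → ¬ y ∈ us → E (hat F us) x y → E F x y
hat-outside []       x∉ y∉ e = e
hat-outside (u ∷ us) x∉ y∉ e =
  chordalize-old (x∉ ∘ here) (y∉ ∘ here) (hat-outside us (x∉ ∘ there) (y∉ ∘ there) e)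

-- An added edge joins two vertices of one hole, and a hole meets `C` at most once. The set `C`
-- stays fixed while `us` shrinks in the recursion.
hat-inside : {F : SG N} {C : List (Fin N)} → IsSimple F → NCset F C → ∀ us → (∀ {u} → u ∈ us → u ∈ C) →
             ∀ {x y} → x ∈ C → y ∈ C → E (hat F us) x y → E F x y
hat-inside F-simple ncs []       us⊆C x∈C y∈C e = e
hat-inside F-simple ncs (u ∷ us) us⊆C x∈C y∈C e
  with hat-inside (chordalize-simple F-simple u) (chordalize-NCset F-simple (us⊆C (here refl)) ncs)
         us (us⊆C ∘ there) x∈C y∈C e
... | inj₁ e′ = e′
... | inj₂ (x≢y , H , H∋x , H∋y , _) = ⊥-elim (x≢y (proj₂ ncs H _ _ x∈C y∈C H∋x H∋y))

unique-++-disjoint : ∀ {A : Set} (xs : List A) {ys} → Unique (xs ++ ys) → ∀ {x} → x ∈ xs → ¬ x ∈ ys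
unique-++-disjoint (x ∷ xs) (x∉ ∷ uniq) (here refl)  x∈ys = All.lookup x∉ (∈-++⁺ʳ xs x∈ys) refl
unique-++-disjoint (x ∷ xs) (_ ∷ uniq)  (there x∈xs) x∈ys = unique-++-disjoint xs uniq x∈xs x∈ys

unique-++⁻ʳ : ∀ {A : Set} (xs : List A) {ys} → Unique (xs ++ ys) → Unique ys
unique-++⁻ʳ []       uniq       = uniq
unique-++⁻ʳ (x ∷ xs) (_ ∷ uniq) = unique-++⁻ʳ xs uniq

unique-lookup : ∀ {A : Set} {xs : List A} → Unique xs → ∀ {i j} → lookup xs i ≡ lookup xs j → i ≡ j
unique-lookup (x∉ ∷ uniq) {zero}  {zero}  eq = refl
unique-lookup (x∉ ∷ uniq) {zero}  {suc j} eq = ⊥-elim (All.lookup x∉ (∈-lookup j) eq)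
unique-lookup (x∉ ∷ uniq) {suc i} {zero}  eq = ⊥-elim (All.lookup x∉ (∈-lookup i) (sym eq))
unique-lookup (x∉ ∷ uniq) {suc i} {suc j} eq = cong suc (unique-lookup uniq eq)

length-filter-¬ : ∀ {A : Set} {P : A → Set} (P? : Decidable P) xs →
                  length (filter P? xs) + length (filter (¬? ∘ P?) xs) ≡ length xs
length-filter-¬ P? [] = refl
length-filter-¬ P? (x ∷ xs) with P? x
... | yes _ = cong suc (length-filter-¬ P? xs)
... | no  _ = trans (+-suc _ _) (cong suc (length-filter-¬ P? xs))

-- Cliques are duplicate-free lists here, rather than injections as in `IsClique`, so that `filter`
-- can split them.
CliqueBound : ∀ {m} → (Fin m → Fin m → Set) → ℕ → Set
CliqueBound R b = ∀ K → Unique K → (∀ {i j} → i ∈ K → j ∈ K → i ≢ j → R i j) → length K ≤ b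

clique-split : ∀ {m a b} {R R₁ R₂ : Fin m → Fin m → Set} {P : Fin m → Set} → Decidable P →
               (∀ {i j} → P i → P j → R i j → R₁ i j) → (∀ {i j} → ¬ P i → ¬ P j → R i j → R₂ i j) →
               CliqueBound R₁ a → CliqueBound R₂ b → CliqueBound R (a + b)
clique-split P? in₁ in₂ bound₁ bound₂ K uniq cl =
  subst (_≤ _) (length-filter-¬ P? K)
    (+-mono-≤
      (bound₁ _ (filter⁺ P? uniq) λ i∈ j∈ i≢j →
        let i∈K , Pi = ∈-filter⁻ P? i∈ ; j∈K , Pj = ∈-filter⁻ P? j∈ in in₁ Pi Pj (cl i∈K j∈K i≢j))
      (bound₂ _ (filter⁺ (¬? ∘ P?) uniq) λ i∈ j∈ i≢j →
        let i∈K , Pi = ∈-filter⁻ (¬? ∘ P?) i∈ ; j∈K , Pj = ∈-filter⁻ (¬? ∘ P?) j∈ in in₂ Pi Pj (cl i∈K j∈K i≢j)))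

cliqueNumber-bound : ∀ (G : Graph) {w} → CliqueNumber G w → CliqueBound (λ i j → adj G i j ≡ true) w
cliqueNumber-bound G (_ , max) K uniq cl =
  max (length K) (lookup K , unique-lookup uniq ,
    λ i j i≢j → cl (∈-lookup i) (∈-lookup j) (i≢j ∘ unique-lookup uniq))

-- Building the completion part by part

true≢false : true ≢ false
true≢false ()

asSG-simple : (G : Graph) → IsSimple (asSG G)
asSG-simple G = record
  { E-sym = λ {x} {y} e → trans (adj-sym G y x) e
  ; E-irr = λ {x} e → true≢false (trans (sym e) (adj-irr G x))
  ; E⇒V   = λ _ → _ }

-- H plays the role of G*ᵢ₋₁ and D that of Cᵢ ∪ … ∪ Cₚ.
record Stage (G : Graph) (H : SG (n G)) (D : List (Fin (n G))) : Set where
  field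
    simple : IsSimple H
    V⇒∉    : ∀ {x} → V H x → ¬ x ∈ D
    ∉⇒V    : ∀ {x} → ¬ x ∈ D → V H x
    covers : ∀ {x y} → E (delete G D) x y → E H x y

open Stage

stage₀ : (G : Graph) (D : List (Fin (n G))) → Stage G (delete G D) D
stage₀ G D = record
  { simple = record
      { E-sym = λ { (e , x∉ , y∉) → E-sym (asSG-simple G) e , y∉ , x∉ }
      ; E-irr = E-irr (asSG-simple G) ∘ proj₁
      ; E⇒V   = proj₁ ∘ proj₂ }
  ; V⇒∉    = id
  ; ∉⇒V    = id
  ; covers = id }

module _ {m : ℕ} (G : Graph) (e : Fin m → Fin (n G)) {w : ℕ}
         (adj-bound : CliqueBound (λ i j → adj G (e i) (e j) ≡ true) w) where

  open DecMembership {A = Fin (n G)} _≟_ using (_∈?_)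

  module Extend {H : SG (n G)} (C D : List (Fin (n G))) (st : Stage G H (C ++ D))
                (uniq : Unique (C ++ D)) where

    Gᵢ : SG (n G)
    Gᵢ = record { V = λ x → V H x ⊎ x ∈ C ; E = λ x y → E H x y ⊎ E (delete G D) x y }

    ∉D⇒V : ∀ {x} → ¬ x ∈ D → V Gᵢ x
    ∉D⇒V {x} x∉D with x ∈? C
    ... | yes x∈C = inj₂ x∈C
    ... | no  x∉C = inj₁ (∉⇒V st ([ x∉C , x∉D ]′ ∘ ∈-++⁻ C))

    Gᵢ-simple : IsSimple Gᵢ
    Gᵢ-simple = record
      { E-sym = λ { (inj₁ xy) → inj₁ (E-sym (simple st) xy)
                  ; (inj₂ (xy , x∉ , y∉)) → inj₂ (E-sym (asSG-simple G) xy , y∉ , x∉) }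
      ; E-irr = λ { (inj₁ xx) → E-irr (simple st) xx ; (inj₂ (xx , _)) → E-irr (asSG-simple G) xx }
      ; E⇒V   = λ { (inj₁ xy) → inj₁ (E⇒V (simple st) xy) ; (inj₂ (_ , x∉D , _)) → ∉D⇒V x∉D } }

    next : Stage G (hat Gᵢ C) D
    next = record
      { simple = hat-simple Gᵢ-simple C
      ; V⇒∉    = λ {x} Vx → [ (λ VHx → V⇒∉ st VHx ∘ ∈-++⁺ʳ C) , unique-++-disjoint C uniq ]′
                             (subst (λ P → P x) (hat-V Gᵢ C) Vx)
      ; ∉⇒V    = λ {x} x∉D → subst (λ P → P x) (sym (hat-V Gᵢ C)) (∉D⇒V x∉D)
      ; covers = hat-mono C ∘ inj₂ }

    next-bound : ∀ {b} → NCset Gᵢ C → CliqueBound (λ i j → E H (e i) (e j)) b →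
                 CliqueBound (λ i j → E (hat Gᵢ C) (e i) (e j)) (w + b)
    next-bound ncs = clique-split (λ i → e i ∈? C) inside outside adj-bound
      where
      inside : ∀ {x y} → x ∈ C → y ∈ C → E (hat Gᵢ C) x y → adj G x y ≡ true
      inside x∈C y∈C xy with hat-inside Gᵢ-simple ncs C id x∈C y∈C xy
      -- The vertices of `C` enter only at this stage, so no edge of `H` meets `C`.
      ... | inj₁ xy′       = ⊥-elim (V⇒∉ st (E⇒V (simple st) xy′) (∈-++⁺ˡ x∈C))
      ... | inj₂ (xy′ , _) = xy′
      outside : ∀ {x y} → ¬ x ∈ C → ¬ y ∈ C → E (hat Gᵢ C) x y → E H x y
      outside x∉C y∉C xy with hat-outside C x∉C y∉C xy
      ... | inj₁ xy′               = xy′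
      ... | inj₂ (xy′ , x∉D , y∉D) =
        covers st (xy′ , [ x∉C , x∉D ]′ ∘ ∈-++⁻ C , [ y∉C , y∉D ]′ ∘ ∈-++⁻ C)

  -- The completion is built on all of `G`, where the partition lives, but cliques are counted only
  -- on the vertices selected by `e`.
  record ChordalCompletion (b : ℕ) : Set₁ where
    field
      graph   : SG (n G)
      graph-simple : IsSimple graph
      chordal : Chordal graph
      extends : ∀ {x y} → adj G x y ≡ true → E graph x y
      bound   : CliqueBound (λ i j → E graph (e i) (e j)) b

  -- Each part adds `w` to the clique bound. Chordality of `H` enters when no part is left, hence
  -- the premise `parts ≡ []`: the first call has a nonempty partition, and every recursive call
  -- passes on the chordality of the preceding `hat`.
  complete : ∀ parts {H b} → (parts ≡ [] → Chordal H) → Stage G H (concat parts) → Unique (concat parts) →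
             LCPSteps G H parts → CliqueBound (λ i j → E H (e i) (e j)) b →
             ChordalCompletion (length parts * w + b)
  complete [] {H} H-chordal st _ _ bound = record
    { graph   = H
    ; graph-simple = simple st
    ; chordal = H-chordal refl
    ; extends = λ xy → covers st (xy , (λ ()) , (λ ()))
    ; bound   = bound }
  complete (C ∷ rest) {H} {b} _ st uniq (_ , ncs , hat-chordal , steps) bound =
    subst ChordalCompletion (reassoc b) (complete rest (λ _ → hat-chordal) next (unique-++⁻ʳ C uniq) steps (next-bound ncs bound))
    where
    open Extend C (concat rest) st uniq
    reassoc : ∀ b → length rest * w + (w + b) ≡ w + length rest * w + b
    reassoc b = trans (sym (+-assoc (length rest * w) w b)) (cong (_+ b) (+-comm (length rest * w) w))

  completion : ∀ {k} → NCIndex≤ G k → ∃ λ b → b ≤ suc k * w × ChordalCompletion b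
  completion {k} (inj₁ chordal) = w , m≤m+n w (k * w) , record
    { graph = asSG G ; graph-simple = asSG-simple G ; chordal = chordal ; extends = id ; bound = adj-bound }
  -- A hole cover is nonempty, so there is at least one part.
  completion {k} (inj₂ ([] , _ , _ , ((_ , ()) , _) , _))
  completion {k} (inj₂ (parts@(_ ∷ _) , p≤k , uniq , _ , steps)) =
    -- The last summand `w` bounds the cliques of the initial graph, `G` without the hole cover.
    length parts * w + w , subst (_≤ suc k * w) (+-comm w _) (+-monoʳ-≤ w (*-monoˡ-≤ w p≤k)) ,
    complete parts (λ ()) (stage₀ G (concat parts)) uniq steps
      (λ K K-uniq cl → adj-bound K K-uniq λ i∈ j∈ i≢j → proj₁ (cl i∈ j∈ i≢j))

-- Simplicial vertices of chordal graphs

-- The size of a possibly undecidable set, used as the measure of the inductions below.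
Bounded : (Fin N → Set) → ℕ → Set
Bounded S b = ∀ xs → Unique xs → All S xs → length xs ≤ b

bounded-remove : ∀ {S S′ : Fin N → Set} {b x} → S x → (∀ {v} → S′ v → S v × x ≢ v) →
                 Bounded S (suc b) → Bounded S′ b
bounded-remove {x = x} Sx sub bound xs uniq S′xs =
  ≤-pred (bound (x ∷ xs) (All.map (proj₂ ∘ sub) S′xs ∷ uniq) (Sx ∷ All.map (proj₁ ∘ sub) S′xs))

bounded-zero : ∀ {S : Fin N → Set} → Bounded S 0 → ∀ {x} → ¬ S x
bounded-zero bound {x} Sx with bound (x ∷ []) ([] ∷ []) (Sx ∷ [])
... | ()

module _ {F : SG N} (F-simple : IsSimple F) (chordal : Chordal F) where

  Simplicial : (Fin N → Set) → Fin N → Set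
  Simplicial S x = ∀ {y z} → S y → S z → E F x y → E F x z → ¬ ¬ Touch F y z

  -- D is the component of w in S minus the closed neighbourhood of v, and B its boundary.
  -- B is a clique, since two non-adjacent vertices of B would lie with v on a hole.
  simplicial-away : ∀ b (S : Fin N → Set) → Bounded S b → ∀ {v w} → S v → S w → ¬ Touch F v w →
                    ¬ ¬ ∃ λ x → S x × ¬ Touch F v x × Simplicial S x
  simplicial-away zero    S bound Sv Sw v-w k = bounded-zero bound Sv
  simplicial-away (suc b) S bound {v} {w} Sv Sw v-w k =
    ¬¬-excluded-middle {A = ∃₂ λ y z → B y × S′ z × ¬ Touch F y z} λ where
      -- The simplicial vertex found misses `y`, hence lies in `D`, because `B` is a clique.
      (yes (_ , _ , By , S′z , y-z)) → simplicial-away b S′ bound′ (inj₂ By) S′z y-z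
        λ { (_ , inj₁ Dx , _ , simp) → finish Dx simp
          ; (_ , inj₂ Bx , y-x , _) → B-clique By Bx y-x }
      (no ¬B) → ¬¬-excluded-middle {A = ∃₂ λ y z → D y × S′ z × ¬ Touch F y z} λ where
        -- By now every vertex of `B` touches all of `S′`, so a vertex that misses `y` again lies in
        -- `D`.
        (yes (_ , _ , Dy , S′z , y-z)) → simplicial-away b S′ bound′ (inj₁ Dy) S′z y-z
          λ { (_ , inj₁ Dx , _ , simp) → finish Dx simp
            ; (_ , inj₂ Bx , y-x , _) → ¬B (_ , _ , Bx , inj₁ Dy , y-x ∘ touch-sym F-simple) }
        -- All of `S′` is a clique, and `w` itself will do.
        (no ¬D) → finish (stop (Sw , v-w)) λ where
          (inj₁ Dy) S′z _ _ y-z → ¬D (_ , _ , Dy , S′z , y-z)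
          (inj₂ By) S′z _ _ y-z → ¬B (_ , _ , By , S′z , y-z)
    where
    D B S′ : Fin N → Set
    D y = Walk F (λ y → S y × ¬ Touch F v y) w y
    B y = S y × E F v y × ∃ λ d → D d × E F y d
    S′ y = D y ⊎ B y

    bound′ : Bounded S′ b
    bound′ = bounded-remove Sv
      (λ { (inj₁ Dy) → proj₁ (walk-end Dy) , proj₂ (walk-end Dy) ∘ inj₁
         ; (inj₂ (Sy , vy , _)) → Sy , λ { refl → E-irr F-simple vy } }) bound

    B-clique : ∀ {y z} → B y → B z → ¬ ¬ Touch F y z
    B-clique {y} {z} (_ , vy , d , Dd , yd) (_ , vz , d′ , Dd′ , zd′) y-z =
      walk-hole F-simple {S = λ x → x ≡ y ⊎ x ≡ z ⊎ ¬ Touch F v x} vy vz (y-z ∘ inj₁) (y-z ∘ inj₂)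
        (λ { (inj₁ refl) → (λ { refl → E-irr F-simple vy }) , λ _ → inj₁ refl
           ; (inj₂ (inj₁ refl)) → (λ { refl → E-irr F-simple vz }) , λ _ → inj₂ refl
           ; (inj₂ (inj₂ v-x)) → (λ { refl → v-x (inj₁ refl) }) , ⊥-elim ∘ v-x ∘ inj₂ })
        (step (inj₁ refl) yd
          (walk-trans (walk-map inside (walk-sym F-simple Dd))
          (walk-trans (walk-map inside Dd′)
            (step (inside (walk-end Dd′)) (E-sym F-simple zd′) (stop (inj₂ (inj₁ refl)))))))
        (chordal ∘ proj₁)
      where
      inside : ∀ {x} → S x × ¬ Touch F v x → x ≡ y ⊎ x ≡ z ⊎ ¬ Touch F v x
      inside = inj₂ ∘ inj₂ ∘ proj₂

    nbr-S′ : ∀ {x y} → D x → S y → E F x y → ¬ ¬ S′ y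
    nbr-S′ {x} {y} Dx Sy xy k = ¬¬-excluded-middle {A = Touch F v y} λ where
      (yes (inj₁ refl)) → proj₂ (walk-end Dx) (inj₂ (E-sym F-simple xy))
      (yes (inj₂ vy)) → k (inj₂ (Sy , vy , x , Dx , E-sym F-simple xy))
      (no v-y) → k (inj₁ (walk-trans Dx (step (walk-end Dx) xy (stop (Sy , v-y)))))

    -- By `nbr-S′` all neighbours in `S` of a vertex of `D` lie in `S′`, so being simplicial in `S′`
    -- is enough.
    finish : ∀ {x} → D x → Simplicial S′ x → ⊥
    finish Dx simp = k (_ , proj₁ (walk-end Dx) , proj₂ (walk-end Dx) , λ Sy Sz xy xz k′ →
      nbr-S′ Dx Sy xy λ S′y → nbr-S′ Dx Sz xz λ S′z → simp S′y S′z xy xz k′)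

  simplicial-exists : ∀ {b S} → Bounded S b → ∀ {v} → S v → ¬ ¬ ∃ λ x → S x × Simplicial S x
  simplicial-exists {b} {S} bound Sv k = ¬¬-excluded-middle {A = ∃₂ λ x y → S x × S y × ¬ Touch F x y} λ where
    (yes (_ , _ , Sx , Sy , x-y)) → simplicial-away b S bound Sx Sy x-y
      λ { (_ , Sx , _ , simp) → k (_ , Sx , simp) }
    (no ¬xy) → k (_ , Sv , λ Sy Sz _ _ y-z → ¬xy (_ , _ , Sy , Sz , y-z))

-- Greedy colouring

¬¬-finite-choice : ∀ {k} {P : Fin k → Set} → (∀ i → ¬ ¬ P i) → ¬ ¬ (∀ i → P i)
¬¬-finite-choice {zero}  f k = k λ ()
¬¬-finite-choice {suc _} f k =
  f zero λ p → ¬¬-finite-choice (f ∘ suc) λ ps → k λ { zero → p ; (suc i) → ps i }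

unique-length : ∀ {m} (xs : List (Fin m)) → Unique xs → length xs ≤ m
unique-length xs uniq = injective⇒≤ (λ eq → unique-lookup uniq eq)

module _ {G : Graph} {k : ℕ} (C : Cover G k) where

  Proper : (Fin (n G) → Set) → (Fin (n G) → Fin k) → Set
  Proper S φ = ∀ u v → S u → S v → M C u v (φ u) (φ v) ≡ false

  module _ {F : SG (n G)} (F-simple : IsSimple F) (chordal : Chordal F)
           (extends : ∀ {x y} → adj G x y ≡ true → E F x y) (bound : CliqueBound (E F) k) where

    -- If every colour were excluded at x, choosing for each colour a neighbour that excludes it
    -- would give k distinct neighbours, hence a clique of size k + 1.
    free-colour : ∀ {S x} (φ : Fin (n G) → Fin k) → Simplicial F-simple chordal S x →
                  ¬ ¬ ∃ λ c → ∀ y → S y → y ≢ x → M C x y c (φ y) ≡ false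
    free-colour {S} {x} φ simp none =
      ¬¬-finite-choice blocked λ block →
      let g = proj₁ ∘ block
          g∈S = λ c → proj₁ (proj₂ (block c))
          g≢x = λ c → proj₁ (proj₂ (proj₂ (block c)))
          hit = λ c → proj₂ (proj₂ (proj₂ (block c)))
          g-adj = λ c → extends (M-edge C _ _ _ _ (hit c))
          -- By the matching condition a coloured neighbour excludes at most one colour at `x`.
          g-inj : ∀ {c c′} → g c ≡ g c′ → c ≡ c′
          g-inj {c} {c′} eq = M-match C (g c) x (φ (g c)) c c′
            (trans (M-sym C _ _ _ _) (hit c))
            (trans (M-sym C _ _ _ _) (subst (λ y → M C x y c′ (φ y) ≡ true) (sym eq) (hit c′)))
      in ¬¬-finite-choice (λ c → ¬¬-finite-choice λ c′ → simp (g∈S c) (g∈S c′) (g-adj c) (g-adj c′)) λ g-touch →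
      let clique : ∀ {y z} → y ∈ x ∷ tabulate g → z ∈ x ∷ tabulate g → y ≢ z → E F y z
          clique = λ { (here refl) (here refl) y≢z → ⊥-elim (y≢z refl)
                     ; (here refl) (there z∈) y≢z → let c , eq = ∈-tabulate⁻ z∈ in subst (E F x) (sym eq) (g-adj c)
                     ; (there y∈) (here refl) y≢z → let c , eq = ∈-tabulate⁻ y∈ in
                         E-sym F-simple (subst (E F x) (sym eq) (g-adj c))
                     ; (there y∈) (there z∈) y≢z → let c , eq = ∈-tabulate⁻ y∈ ; c′ , eq′ = ∈-tabulate⁻ z∈ in
                         [ (λ same → ⊥-elim (y≢z (trans eq (trans same (sym eq′)))))
                         , subst₂ (E F) (sym eq) (sym eq′) ]′ (g-touch c c′) }
      in <-irrefl refl (subst (_≤ k) (cong suc (length-tabulate g))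
           (bound (x ∷ tabulate g) (All.tabulate⁺ (≢-sym ∘ g≢x) ∷ tabulate⁺ g-inj) clique))
      where
      blocked : ∀ c → ¬ ¬ ∃ λ y → S y × y ≢ x × M C x y c (φ y) ≡ true
      blocked c free = none (c , λ y Sy y≢x → ¬-not λ hit → free (y , Sy , y≢x , hit))

    -- Remove a simplicial vertex, colour the rest and give the vertex a free colour. The colour
    -- `c₀` is the default value outside `S`.
    colour : ∀ b {S} → Bounded S b → Fin k → ¬ ¬ ∃ (Proper S)
    colour zero    bd c₀ no-φ = no-φ ((λ _ → c₀) , λ _ _ Su _ → ⊥-elim (bounded-zero bd Su))
    colour (suc b) {S} bd c₀ no-φ = ¬¬-excluded-middle {A = ∃ S} λ where
        (no empty)     → no-φ ((λ _ → c₀) , λ u _ Su _ → ⊥-elim (empty (u , Su)))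
        (yes (_ , Sv)) →
          simplicial-exists F-simple chordal bd Sv λ { (x , Sx , simp) →
          colour b (bounded-remove {S′ = λ v → S v × x ≢ v} Sx id bd) c₀ λ { (φ , proper) →
          free-colour φ simp λ { (c , free) →
          no-φ (recolour φ x c , recolour-proper φ x c proper free) } } }
      where
      recolour : (Fin (n G) → Fin k) → Fin (n G) → Fin k → Fin (n G) → Fin k
      recolour φ x c v with v ≟ x
      ... | yes _ = c
      ... | no  _ = φ v

      M-irr : ∀ x c c′ → M C x x c c′ ≡ false
      M-irr x c c′ = ¬-not λ hit → true≢false (trans (sym (M-edge C x x c c′ hit)) (adj-irr G x))

      recolour-proper : ∀ φ x c → Proper (λ v → S v × x ≢ v) φ → (∀ y → S y → y ≢ x → M C x y c (φ y) ≡ false) →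
                        Proper S (recolour φ x c)
      recolour-proper φ x c proper free u v Su Sv with u ≟ x | v ≟ x
      ... | yes refl | yes refl = M-irr x c c
      ... | yes refl | no v≢x   = free v Sv v≢x
      ... | no u≢x   | yes refl = trans (M-sym C u x (φ u) c) (free u Su u≢x)
      ... | no u≢x   | no v≢x   = proper u v (Su , ≢-sym u≢x) (Sv , ≢-sym v≢x)

  -- There are `k ^ n G` maps to test. This decidability removes the double negations gathered so
  -- far.
  colouring? : Dec (Σ (Fin (n G) → Fin k) λ φ → ∀ u v → M C u v (φ u) (φ v) ≡ false)
  colouring? = map′
    (λ { (i , proper) → finToFun i , proper })
    (λ { (φ , proper) → funToFin φ , λ u v →
         subst₂ (λ c c′ → M C u v c c′ ≡ false) (sym (finToFun-funToFin φ u)) (sym (finToFun-funToFin φ v)) (proper u v) })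
    (any? {n = k ^ n G} λ i → all? λ u → all? λ v → M C u v (finToFun i u) (finToFun i v) Bool.≟ false)

chordal-DPColorable : ∀ {G : Graph} {F : SG (n G)} {k} → IsSimple F → Chordal F →
                      (∀ {x y} → adj G x y ≡ true → E F x y) → CliqueBound (E F) k → DPColorable G k
chordal-DPColorable {G} {F} {k} F-simple chordal extends bound C =
  -- A default colour is available only if there is a vertex. Without colourings there can be no
  -- vertex, and then the empty map is a colouring.
  decidable-stable (colouring? C) λ no-φ → no-φ ((λ v → ⊥-elim (vertex⇒⊥ no-φ v)) , λ v → ⊥-elim (vertex⇒⊥ no-φ v))
  where
  vertex⇒⊥ : ¬ (Σ (Fin (n G) → Fin k) λ φ → ∀ u v → M C u v (φ u) (φ v) ≡ false) → ¬ Fin (n G)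
  vertex⇒⊥ no-φ v =
    -- The type `Fin (n G)`, inhabited by `v`, stands for truth, so that `S` is the set of all
    -- vertices.
    colour C F-simple chordal extends bound (n G) {S = λ _ → Fin (n G)} (λ xs uniq _ → unique-length xs uniq)
      -- The single vertex `v` is a clique, so `k` is at least 1 and 0 is a colour.
      (fromℕ< (bound (v ∷ []) ([] ∷ []) λ { (here refl) (here refl) v≢v → ⊥-elim (v≢v refl) }))
      λ { (φ , proper) → no-φ (φ , λ x y → proper x y x y) }

-- Restriction to induced subgraphs and the theorem

pullback : ∀ {N m} → SG N → (Fin m → Fin N) → SG m
pullback F e = record { V = V F ∘ e ; E = λ i j → E F (e i) (e j) }

pullback-simple : ∀ {N m} {F : SG N} (e : Fin m → Fin N) → IsSimple F → IsSimple (pullback F e)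
pullback-simple e F-simple = record { E-sym = E-sym F-simple ; E-irr = E-irr F-simple ; E⇒V = E⇒V F-simple }

pullback-chordal : ∀ {N m} {F : SG N} {e : Fin m → Fin N} → Injective _≡_ _≡_ e → Chordal F → Chordal (pullback F e)
pullback-chordal {e = e} e-inj chordal H = chordal record
  { len    = len H
  ; len≥4  = len≥4 H
  ; vs     = e ∘ vs H
  ; vs-inj = vs-inj H ∘ e-inj
  ; vs-V   = vs-V H
  ; edge⇒  = edge⇒ H
  ; ⇒edge  = ⇒edge H
  }

theorem5p1 : (k : ℕ) (𝓕 : Graph → Set) → (∀ G → 𝓕 G → NCIndex≤ G k) →
    Σ (ℕ → ℕ) λ f → ∀ G → 𝓕 G →
    (m : ℕ) (e : Fin m → Fin (n G)) → Injective _≡_ _≡_ e →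
    (w : ℕ) → CliqueNumber (induced G m e) w → DPχ≤ (induced G m e) (f w)
-- The index is bounded for `G` and not for its induced subgraphs, so the completion of `G` is
-- pulled back along `e`. The factor `suc k` counts at most `k` parts and the graph left after
-- deleting them.
theorem5p1 k 𝓕 index≤k = (λ w → suc k * w) , λ G G∈𝓕 m e e-inj w ω≡w →
  let b , b≤ , completed = completion G e (cliqueNumber-bound (induced G m e) ω≡w) (index≤k G G∈𝓕)
      open ChordalCompletion completed
  in b , b≤ , chordal-DPColorable (pullback-simple e graph-simple) (pullback-chordal e-inj chordal) extends bound
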